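{- Let $N, N_1, N_2$ be terms, $\varepsilon\in{\cal E}$ and $\overline{V}$ a sequence of elements of ${\cal E}$ such that the sequence $\varepsilon\ \overline{V}$ is nice, and such that the terms below are typed. If $S_2=(N\ [x_1.(N_1\ \varepsilon),x_2.(N_2\ \varepsilon)]\ \overline{V})\in SN$, then $S_1=(N\ [x_1.N_1,x_2.N_2]\ \varepsilon\ \overline{V})\in SN$.
   Context: Formulas: atoms, $\perp$, $\rightarrow,\wedge,\vee$; $\neg A=A\rightarrow\perp$. Intuitionistic variables $x,y,\dots$, classical variables $a,b,\dots$. Terms: ${\cal T} ::= x \mid \lambda x\, {\cal T} \mid ({\cal T}\ {\cal E}) \mid \langle {\cal T},{\cal T}\rangle \mid \omega_1 {\cal T} \mid \omega_2 {\cal T} \mid \mu a\, {\cal T} \mid (a\ {\cal T})$, ${\cal E} ::= {\cal T} \mid \pi_1 \mid \pi_2 \mid [x.{\cal T}, y.{\cal T}]$; $(M\ E_1\dots E_n)=((M\ E_1)\dots E_n)$. Typing (contexts contain $x:A$, $a:\neg A$): $x:A$ for declared $x$; $\langle M,N\rangle:A\wedge B$ from $M:A,N:B$; $(M\ \pi_i):A_i$ from $M:A_1\wedge A_2$; $\lambda xM:A\rightarrow B$ from $M:B$ under $x:A$; $(M\ N):B$ from $M:A\rightarrow B,N:A$; $\omega_iM:A_1\vee A_2$ from $M:A_i$; $(M\ [x_1.N_1,x_2.N_2]):C$ from $M:A_1\vee A_2$ and $N_i:C$ under $x_i:A_i$; $\mu aM:A$ from $M:\perp$ under $a:\neg A$;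 $(a\ M):\perp$ from $M:A$ under $a:\neg A$. Typed = has a type in some context. Reduction $\triangleright$: compatible closure of $(\lambda x M\ N)\triangleright M[x:=N]$; $(\langle M_1,M_2\rangle\ \pi_i)\triangleright M_i$; $(\omega_i M\ [x_1.N_1,x_2.N_2])\triangleright N_i[x_i:=M]$; $(M\ [x_1.N_1,x_2.N_2]\ \varepsilon)\triangleright (M\ [x_1.(N_1\ \varepsilon),x_2.(N_2\ \varepsilon)])$; $(\mu a M\ \varepsilon)\triangleright \mu a\, M[a:=^*\varepsilon]$ ($M[a:=^*\varepsilon]$ replaces each subterm $(a\ P)$ by $(a\ (P\ \varepsilon))$). $SN$: no infinite reduction sequence. A (possibly empty) sequence $E_1,\dots,E_n$ of elements of ${\cal E}$ is nice if each $E_i\in{\cal T}\cup\{\pi_1,\pi_2\}$ except possibly $E_n$. -}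

module Defs where

open import Data.Nat using (ℕ; zero; suc; pred; _<ᵇ_; _≡ᵇ_)
open import Data.Bool using (if_then_else_)
open import Data.List using (List; []; _∷_)
open import Data.Product using (∃; ∃-syntax; _×_)
open import Data.Unit using (⊤)
open import Data.Empty using (⊥)
open import Induction.WellFounded using (Acc)

infixr 7 _⇒_
infixr 8 _∨_
infixr 9 _∧_

data Form : Set where
  atom : ℕ → Form
  ⊥′   : Form
  _⇒_  : Form → Form → Form
  _∧_  : Form → Form → Form
  _∨_  : Form → Form → Form

¬′_ : Form → Form
¬′ A = A ⇒ ⊥′

-- Terms (de Bruijn; two independent index spaces: intuitionistic
-- variables x and classical variables a)

mutual
  data Term : Set where
    var  : ℕ → Term
    lam  : Term → Term           -- λx T        (binds an intuitionistic var)
    app  : Term → Elim → Term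
    pair : Term → Term → Term
    ω₁   : Term → Term
    ω₂   : Term → Term
    mu   : Term → Term           -- μa T        (binds a classical var)
    capp : ℕ → Term → Term

  data Elim : Set where
    tm   : Term → Elim
    π₁   : Elim
    π₂   : Elim
    case : Term → Term → Elim    -- [x₁.T , x₂.T] (each branch binds an intuitionistic var)

apps : Term → List Elim → Term
apps M []       = M
apps M (E ∷ Es) = apps (app M E) Es

mutual
  shiftI : ℕ → Term → Term
  shiftI c (var x)    = if x <ᵇ c then var x else var (suc x)
  shiftI c (lam M)    = lam (shiftI (suc c) M)
  shiftI c (app M E)  = app (shiftI c M) (shiftIE c E)
  shiftI c (pair M N) = pair (shiftI c M) (shiftI c N)
  shiftI c (ω₁ M)     = ω₁ (shiftI c M)
  shiftI c (ω₂ M)     = ω₂ (shiftI c M)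
  shiftI c (mu M)     = mu (shiftI c M)
  shiftI c (capp a M) = capp a (shiftI c M)

  shiftIE : ℕ → Elim → Elim
  shiftIE c (tm M)       = tm (shiftI c M)
  shiftIE c π₁           = π₁
  shiftIE c π₂           = π₂
  shiftIE c (case N₁ N₂) = case (shiftI (suc c) N₁) (shiftI (suc c) N₂)

mutual
  shiftC : ℕ → Term → Term
  shiftC c (var x)    = var x
  shiftC c (lam M)    = lam (shiftC c M)
  shiftC c (app M E)  = app (shiftC c M) (shiftCE c E)
  shiftC c (pair M N) = pair (shiftC c M) (shiftC c N)
  shiftC c (ω₁ M)     = ω₁ (shiftC c M)
  shiftC c (ω₂ M)     = ω₂ (shiftC c M)
  shiftC c (mu M)     = mu (shiftC (suc c) M)
  shiftC c (capp a M) = capp (if a <ᵇ c then a else suc a) (shiftC c M)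

  shiftCE : ℕ → Elim → Elim
  shiftCE c (tm M)       = tm (shiftC c M)
  shiftCE c π₁           = π₁
  shiftCE c π₂           = π₂
  shiftCE c (case N₁ N₂) = case (shiftC c N₁) (shiftC c N₂)

mutual
  substI : ℕ → Term → Term → Term
  substI k N (var x)    = if x <ᵇ k then var x else (if x ≡ᵇ k then N else var (pred x))
  substI k N (lam M)    = lam (substI (suc k) (shiftI 0 N) M)
  substI k N (app M E)  = app (substI k N M) (substIE k N E)
  substI k N (pair M P) = pair (substI k N M) (substI k N P)
  substI k N (ω₁ M)     = ω₁ (substI k N M)
  substI k N (ω₂ M)     = ω₂ (substI k N M)
  substI k N (mu M)     = mu (substI k (shiftC 0 N) M)
  substI k N (capp a M) = capp a (substI k N M)

  substIE : ℕ → Term → Elim → Elim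
  substIE k N (tm M)       = tm (substI k N M)
  substIE k N π₁           = π₁
  substIE k N π₂           = π₂
  substIE k N (case N₁ N₂) = case (substI (suc k) (shiftI 0 N) N₁) (substI (suc k) (shiftI 0 N) N₂)

mutual
  ssub : ℕ → Elim → Term → Term
  ssub a ε (var x)    = var x
  ssub a ε (lam M)    = lam (ssub a (shiftIE 0 ε) M)
  ssub a ε (app M E)  = app (ssub a ε M) (ssubE a ε E)
  ssub a ε (pair M N) = pair (ssub a ε M) (ssub a ε N)
  ssub a ε (ω₁ M)     = ω₁ (ssub a ε M)
  ssub a ε (ω₂ M)     = ω₂ (ssub a ε M)
  ssub a ε (mu M)     = mu (ssub (suc a) (shiftCE 0 ε) M)
  ssub a ε (capp b P) = if b ≡ᵇ a then capp b (app (ssub a ε P) ε) else capp b (ssub a ε P)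

  ssubE : ℕ → Elim → Elim → Elim
  ssubE a ε (tm M)       = tm (ssub a ε M)
  ssubE a ε π₁           = π₁
  ssubE a ε π₂           = π₂
  ssubE a ε (case N₁ N₂) = case (ssub a (shiftIE 0 ε) N₁) (ssub a (shiftIE 0 ε) N₂)

infix 4 _▷_ _▷ₑ_

mutual
  data _▷_ : Term → Term → Set where
    β      : ∀ {M N} → app (lam M) (tm N) ▷ substI 0 N M
    π₁β    : ∀ {M₁ M₂} → app (pair M₁ M₂) π₁ ▷ M₁
    π₂β    : ∀ {M₁ M₂} → app (pair M₁ M₂) π₂ ▷ M₂
    ω₁β    : ∀ {M N₁ N₂} → app (ω₁ M) (case N₁ N₂) ▷ substI 0 M N₁
    ω₂β    : ∀ {M N₁ N₂} → app (ω₂ M) (case N₁ N₂) ▷ substI 0 M N₂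
    perm   : ∀ {M N₁ N₂ ε} →
             app (app M (case N₁ N₂)) ε ▷
             app M (case (app N₁ (shiftIE 0 ε)) (app N₂ (shiftIE 0 ε)))
    μβ     : ∀ {M ε} → app (mu M) ε ▷ mu (ssub 0 (shiftCE 0 ε) M)
    c-lam  : ∀ {M M'} → M ▷ M' → lam M ▷ lam M'
    c-appˡ : ∀ {M M' E} → M ▷ M' → app M E ▷ app M' E
    c-appʳ : ∀ {M E E'} → E ▷ₑ E' → app M E ▷ app M E'
    c-pairˡ : ∀ {M M' N} → M ▷ M' → pair M N ▷ pair M' N
    c-pairʳ : ∀ {M N N'} → N ▷ N' → pair M N ▷ pair M N'
    c-ω₁   : ∀ {M M'} → M ▷ M' → ω₁ M ▷ ω₁ M'
    c-ω₂   : ∀ {M M'} → M ▷ M' → ω₂ M ▷ ω₂ M'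
    c-mu   : ∀ {M M'} → M ▷ M' → mu M ▷ mu M'
    c-capp : ∀ {a M M'} → M ▷ M' → capp a M ▷ capp a M'

  data _▷ₑ_ : Elim → Elim → Set where
    c-tm    : ∀ {M M'} → M ▷ M' → tm M ▷ₑ tm M'
    c-caseˡ : ∀ {N₁ N₁' N₂} → N₁ ▷ N₁' → case N₁ N₂ ▷ₑ case N₁' N₂
    c-caseʳ : ∀ {N₁ N₂ N₂'} → N₂ ▷ N₂' → case N₁ N₂ ▷ₑ case N₁ N₂'

_◁_ : Term → Term → Set
N ◁ M = M ▷ N

SN : Term → Set
SN = Acc _◁_

-- Typing.  Γ lists the types of intuitionistic variables x : A,
-- Δ lists the A for classical variables a : ¬A.

infix 4 _∋_∶_
data _∋_∶_ : List Form → ℕ → Form → Set where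
  here  : ∀ {Γ A} → (A ∷ Γ) ∋ zero ∶ A
  there : ∀ {Γ A B n} → Γ ∋ n ∶ A → (B ∷ Γ) ∋ suc n ∶ A

infix 3 _∣_⊢_∶_
data _∣_⊢_∶_ (Γ Δ : List Form) : Term → Form → Set where
  t-var  : ∀ {x A} → Γ ∋ x ∶ A → Γ ∣ Δ ⊢ var x ∶ A
  t-pair : ∀ {M N A B} → Γ ∣ Δ ⊢ M ∶ A → Γ ∣ Δ ⊢ N ∶ B → Γ ∣ Δ ⊢ pair M N ∶ A ∧ B
  t-π₁   : ∀ {M A B} → Γ ∣ Δ ⊢ M ∶ A ∧ B → Γ ∣ Δ ⊢ app M π₁ ∶ A
  t-π₂   : ∀ {M A B} → Γ ∣ Δ ⊢ M ∶ A ∧ B → Γ ∣ Δ ⊢ app M π₂ ∶ B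
  t-lam  : ∀ {M A B} → (A ∷ Γ) ∣ Δ ⊢ M ∶ B → Γ ∣ Δ ⊢ lam M ∶ A ⇒ B
  t-app  : ∀ {M N A B} → Γ ∣ Δ ⊢ M ∶ A ⇒ B → Γ ∣ Δ ⊢ N ∶ A → Γ ∣ Δ ⊢ app M (tm N) ∶ B
  t-ω₁   : ∀ {M A B} → Γ ∣ Δ ⊢ M ∶ A → Γ ∣ Δ ⊢ ω₁ M ∶ A ∨ B
  t-ω₂   : ∀ {M A B} → Γ ∣ Δ ⊢ M ∶ B → Γ ∣ Δ ⊢ ω₂ M ∶ A ∨ B
  t-case : ∀ {M N₁ N₂ A B C} → Γ ∣ Δ ⊢ M ∶ A ∨ B →
           (A ∷ Γ) ∣ Δ ⊢ N₁ ∶ C → (B ∷ Γ) ∣ Δ ⊢ N₂ ∶ C →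
           Γ ∣ Δ ⊢ app M (case N₁ N₂) ∶ C
  t-mu   : ∀ {M A} → Γ ∣ (A ∷ Δ) ⊢ M ∶ ⊥′ → Γ ∣ Δ ⊢ mu M ∶ A
  t-capp : ∀ {a M A} → Δ ∋ a ∶ A → Γ ∣ Δ ⊢ M ∶ A → Γ ∣ Δ ⊢ capp a M ∶ ⊥′

Typed : Term → Set
Typed M = ∃[ Γ ] ∃[ Δ ] ∃[ A ] (Γ ∣ Δ ⊢ M ∶ A)

NotCase : Elim → Set
NotCase (tm _)     = ⊤
NotCase π₁         = ⊤
NotCase π₂         = ⊤
NotCase (case _ _) = ⊥

Nice : List Elim → Set
Nice []            = ⊤
Nice (E ∷ [])      = ⊤
Nice (E ∷ E' ∷ Es) = NotCase E × Nice (E' ∷ Es)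

{-# OPTIONS --safe #-}
-- Every typed term is strongly normalising, by orthogonality between terms and
-- stacks of eliminators; S₁ is typed.
-- A formula A denotes a set of stacks, and a term is reducible at A when it is
-- SN against each of them.  A stack [x₁.N₁ , x₂.N₂] ∷ V is admitted at A₁ ∨ A₂ as
-- soon as (Nᵢ[xᵢ:=P] V) is SN for every reducible P : Aᵢ, with no condition on
-- the type of V.  This condition does not change under the permutative
-- conversion, which becomes a reduction of stacks that shortens them.
-- Classical variables are substituted by stacks, so that (a P) becomes
-- (b (P V)) and μ is treated like λ.
module Submission where

open import Defs
open import Data.Bool using (true; false; if_then_else_)
open import Data.List using (List; []; _∷_; _++_; map; length)
open import Data.List.Properties using (map-++; map-∘; map-cong; map-id; ++-identityʳ)
open import Data.Nat using (ℕ; zero; suc; _<ᵇ_; _≡ᵇ_; _≤_; s≤s)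
open import Data.Nat.Properties using (≤-refl; ≤-trans; n≤1+n)
open import Data.Product using (_×_; _,_; proj₁; proj₂)
open import Function using (id; _∘_; flip)
open import Induction.WellFounded using (Acc; acc; acc-inverse)
open import Relation.Binary.Construct.Closure.ReflexiveTransitive using (Star; _◅_; gmap) renaming (ε to refl*)
open import Relation.Binary.PropositionalEquality
  using (_≡_; _≗_; refl; sym; trans; cong; cong₂; subst; module ≡-Reasoning)

-- Renamings

infixr 6 _•_
_•_ : {A : Set} → A → (ℕ → A) → ℕ → A
(x • f) zero    = x
(x • f) (suc n) = f n

lift : (ℕ → ℕ) → ℕ → ℕ
lift ρ = 0 • (suc ∘ ρ)

-- The weakening `h` and the image `c` of index 0 are left open, so that one lemma takes equations
-- under a binder for renamings and for both kinds of substitution.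
•-lift : {A B : Set} {c : B} (h : A → B) {f g : ℕ → A} {ρ : ℕ → ℕ} →
         f ∘ ρ ≗ g → (c • (h ∘ f)) ∘ lift ρ ≗ c • (h ∘ g)
•-lift h eq zero    = refl
•-lift h eq (suc n) = cong h (eq n)

mutual
  ren : (ℕ → ℕ) → (ℕ → ℕ) → Term → Term
  ren ρ κ (var x)    = var (ρ x)
  ren ρ κ (lam M)    = lam (ren (lift ρ) κ M)
  ren ρ κ (app M E)  = app (ren ρ κ M) (renE ρ κ E)
  ren ρ κ (pair M N) = pair (ren ρ κ M) (ren ρ κ N)
  ren ρ κ (ω₁ M)     = ω₁ (ren ρ κ M)
  ren ρ κ (ω₂ M)     = ω₂ (ren ρ κ M)
  ren ρ κ (mu M)     = mu (ren ρ (lift κ) M)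
  ren ρ κ (capp a M) = capp (κ a) (ren ρ κ M)

  renE : (ℕ → ℕ) → (ℕ → ℕ) → Elim → Elim
  renE ρ κ (tm M)       = tm (ren ρ κ M)
  renE ρ κ π₁           = π₁
  renE ρ κ π₂           = π₂
  renE ρ κ (case N₁ N₂) = case (ren (lift ρ) κ N₁) (ren (lift ρ) κ N₂)

mutual
  -- The composite is given up to pointwise equality, because lifting commutes with composition only
  -- pointwise; this avoids function extensionality. The later laws have the same form.
  ren-ren : ∀ {ρ₁ κ₁ ρ₂ κ₂ ρ κ} → ρ₂ ∘ ρ₁ ≗ ρ → κ₂ ∘ κ₁ ≗ κ →
            ∀ M → ren ρ₂ κ₂ (ren ρ₁ κ₁ M) ≡ ren ρ κ M
  ren-ren p q (var x)    = cong var (p x)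
  ren-ren p q (lam M)    = cong lam (ren-ren (•-lift suc p) q M)
  ren-ren p q (app M E)  = cong₂ app (ren-ren p q M) (renE-renE p q E)
  ren-ren p q (pair M N) = cong₂ pair (ren-ren p q M) (ren-ren p q N)
  ren-ren p q (ω₁ M)     = cong ω₁ (ren-ren p q M)
  ren-ren p q (ω₂ M)     = cong ω₂ (ren-ren p q M)
  ren-ren p q (mu M)     = cong mu (ren-ren p (•-lift suc q) M)
  ren-ren p q (capp a M) = cong₂ capp (q a) (ren-ren p q M)

  renE-renE : ∀ {ρ₁ κ₁ ρ₂ κ₂ ρ κ} → ρ₂ ∘ ρ₁ ≗ ρ → κ₂ ∘ κ₁ ≗ κ →
              ∀ E → renE ρ₂ κ₂ (renE ρ₁ κ₁ E) ≡ renE ρ κ E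
  renE-renE p q (tm M)       = cong tm (ren-ren p q M)
  renE-renE p q π₁           = refl
  renE-renE p q π₂           = refl
  renE-renE p q (case N₁ N₂) =
    cong₂ case (ren-ren (•-lift suc p) q N₁) (ren-ren (•-lift suc p) q N₂)

-- Simultaneous substitution

-- The image (b , V) of a classical variable a sends (a P) to (b (P V)).
Cov : Set
Cov = ℕ × List Elim

renC : (ℕ → ℕ) → (ℕ → ℕ) → Cov → Cov
renC ρ κ (b , V) = κ b , map (renE ρ κ) V

cov : ∀ {b V W} → V ≡ W → _≡_ {A = Cov} (b , V) (b , W)
cov = cong (_ ,_)

idC : ℕ → Cov
idC a = a , []

liftI : (ℕ → Term) → ℕ → Term
liftI τ = var 0 • (ren suc id ∘ τ)

liftC : (ℕ → Cov) → ℕ → Cov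
liftC θ = (0 , []) • (renC id suc ∘ θ)

mutual
  sub : (ℕ → Term) → (ℕ → Cov) → Term → Term
  sub τ θ (var x)    = τ x
  sub τ θ (lam M)    = lam (sub (liftI τ) (renC suc id ∘ θ) M)
  sub τ θ (app M E)  = app (sub τ θ M) (subE τ θ E)
  sub τ θ (pair M N) = pair (sub τ θ M) (sub τ θ N)
  sub τ θ (ω₁ M)     = ω₁ (sub τ θ M)
  sub τ θ (ω₂ M)     = ω₂ (sub τ θ M)
  sub τ θ (mu M)     = mu (sub (ren id suc ∘ τ) (liftC θ) M)
  sub τ θ (capp a M) = capp (proj₁ (θ a)) (apps (sub τ θ M) (proj₂ (θ a)))

  subE : (ℕ → Term) → (ℕ → Cov) → Elim → Elim
  subE τ θ (tm M)       = tm (sub τ θ M)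
  subE τ θ π₁           = π₁
  subE τ θ π₂           = π₂
  subE τ θ (case N₁ N₂) =
    case (sub (liftI τ) (renC suc id ∘ θ) N₁) (sub (liftI τ) (renC suc id ∘ θ) N₂)

-- Composition of classical substitutions: (b (P V)) turns into the image of b around P and the
-- substituted V, so the stack of b comes last.
subC : (ℕ → Term) → (ℕ → Cov) → Cov → Cov
subC τ θ (b , V) = proj₁ (θ b) , map (subE τ θ) V ++ proj₂ (θ b)

-- Composition of renamings and substitutions.

mutual
  sub-ren : ∀ {ρ κ τ θ τ′ θ′} → τ ∘ ρ ≗ τ′ → θ ∘ κ ≗ θ′ →
            ∀ M → sub τ θ (ren ρ κ M) ≡ sub τ′ θ′ M
  sub-ren p q (var x)    = p x
  sub-ren p q (lam M)    = cong lam (sub-ren (•-lift (ren suc id) p) (cong (renC suc id) ∘ q) M)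
  sub-ren p q (app M E)  = cong₂ app (sub-ren p q M) (subE-renE p q E)
  sub-ren p q (pair M N) = cong₂ pair (sub-ren p q M) (sub-ren p q N)
  sub-ren p q (ω₁ M)     = cong ω₁ (sub-ren p q M)
  sub-ren p q (ω₂ M)     = cong ω₂ (sub-ren p q M)
  sub-ren p q (mu M)     = cong mu (sub-ren (cong (ren id suc) ∘ p) (•-lift (renC id suc) q) M)
  sub-ren p q (capp a M) =
    cong₂ (λ c N → capp (proj₁ c) (apps N (proj₂ c))) (q a) (sub-ren p q M)

  subE-renE : ∀ {ρ κ τ θ τ′ θ′} → τ ∘ ρ ≗ τ′ → θ ∘ κ ≗ θ′ →
              ∀ E → subE τ θ (renE ρ κ E) ≡ subE τ′ θ′ E
  subE-renE p q (tm M)       = cong tm (sub-ren p q M)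
  subE-renE p q π₁           = refl
  subE-renE p q π₂           = refl
  subE-renE p q (case N₁ N₂) =
    cong₂ case (sub-ren (•-lift (ren suc id) p) (cong (renC suc id) ∘ q) N₁)
               (sub-ren (•-lift (ren suc id) p) (cong (renC suc id) ∘ q) N₂)

map-swap : {f g f′ g′ : Elim → Elim} → f ∘ g ≗ f′ ∘ g′ →
           map f ∘ map g ≗ map f′ ∘ map g′
map-swap eq V = trans (sym (map-∘ V)) (trans (map-cong eq V) (map-∘ V))

ren-apps : ∀ {ρ κ} M V → ren ρ κ (apps M V) ≡ apps (ren ρ κ M) (map (renE ρ κ) V)
ren-apps M []      = refl
ren-apps M (E ∷ V) = ren-apps (app M E) V

renI-renI : ∀ {ρ κ} M → ren (lift ρ) κ (ren suc id M) ≡ ren suc id (ren ρ κ M)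
renI-renI M = trans (ren-ren (λ _ → refl) (λ _ → refl) M)
                    (sym (ren-ren (λ _ → refl) (λ _ → refl) M))

renC-renC : ∀ {ρ κ} M → ren ρ (lift κ) (ren id suc M) ≡ ren id suc (ren ρ κ M)
renC-renC M = trans (ren-ren (λ _ → refl) (λ _ → refl) M)
                    (sym (ren-ren (λ _ → refl) (λ _ → refl) M))

renEI-renEI : ∀ {ρ κ} E → renE (lift ρ) κ (renE suc id E) ≡ renE suc id (renE ρ κ E)
renEI-renEI E = trans (renE-renE (λ _ → refl) (λ _ → refl) E)
                      (sym (renE-renE (λ _ → refl) (λ _ → refl) E))

renEC-renEC : ∀ {ρ κ} E → renE ρ (lift κ) (renE id suc E) ≡ renE id suc (renE ρ κ E)
renEC-renEC E = trans (renE-renE (λ _ → refl) (λ _ → refl) E)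
                      (sym (renE-renE (λ _ → refl) (λ _ → refl) E))

ren-liftI : ∀ {ρ κ τ τ′} → ren ρ κ ∘ τ ≗ τ′ → ren (lift ρ) κ ∘ liftI τ ≗ liftI τ′
ren-liftI         p zero    = refl
ren-liftI {τ = τ} p (suc x) = trans (renI-renI (τ x)) (cong (ren suc id) (p x))

ren-liftC : ∀ {ρ κ} θ {θ′} → renC ρ κ ∘ θ ≗ θ′ → renC ρ (lift κ) ∘ liftC θ ≗ liftC θ′
ren-liftC θ q zero    = refl
ren-liftC θ q (suc a) =
  trans (cov (map-swap renEC-renEC (proj₂ (θ a)))) (cong (renC id suc) (q a))

renC-underI : ∀ {ρ κ} (θ : ℕ → Cov) {θ′} → renC ρ κ ∘ θ ≗ θ′ →
              renC (lift ρ) κ ∘ (renC suc id ∘ θ) ≗ renC suc id ∘ θ′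
renC-underI θ q a =
  trans (cov (map-swap renEI-renEI (proj₂ (θ a)))) (cong (renC suc id) (q a))

mutual
  ren-sub : ∀ {ρ κ τ θ τ′ θ′} → ren ρ κ ∘ τ ≗ τ′ → renC ρ κ ∘ θ ≗ θ′ →
            ∀ M → ren ρ κ (sub τ θ M) ≡ sub τ′ θ′ M
  ren-sub p q (var x)    = p x
  ren-sub {θ = θ} p q (lam M)    = cong lam (ren-sub (ren-liftI p) (renC-underI θ q) M)
  ren-sub p q (app M E)  = cong₂ app (ren-sub p q M) (renE-subE p q E)
  ren-sub p q (pair M N) = cong₂ pair (ren-sub p q M) (ren-sub p q N)
  ren-sub p q (ω₁ M)     = cong ω₁ (ren-sub p q M)
  ren-sub p q (ω₂ M)     = cong ω₂ (ren-sub p q M)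
  ren-sub {τ = τ} {θ} p q (mu M) =
    cong mu (ren-sub (λ x → trans (renC-renC (τ x)) (cong (ren id suc) (p x))) (ren-liftC θ q) M)
  ren-sub {θ = θ} p q (capp a M) =
    trans (cong (capp _) (ren-apps _ (proj₂ (θ a))))
          (cong₂ (λ c N → capp (proj₁ c) (apps N (proj₂ c))) (q a) (ren-sub p q M))

  renE-subE : ∀ {ρ κ τ θ τ′ θ′} → ren ρ κ ∘ τ ≗ τ′ → renC ρ κ ∘ θ ≗ θ′ →
              ∀ E → renE ρ κ (subE τ θ E) ≡ subE τ′ θ′ E
  renE-subE p q (tm M)       = cong tm (ren-sub p q M)
  renE-subE p q π₁           = refl
  renE-subE p q π₂           = refl
  renE-subE {θ = θ} p q (case N₁ N₂) =
    cong₂ case (ren-sub (ren-liftI p) (renC-underI θ q) N₁)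
               (ren-sub (ren-liftI p) (renC-underI θ q) N₂)

sub-apps : ∀ {τ θ} M V → sub τ θ (apps M V) ≡ apps (sub τ θ M) (map (subE τ θ) V)
sub-apps M []      = refl
sub-apps M (E ∷ V) = sub-apps (app M E) V

apps-++ : ∀ M V W → apps (apps M V) W ≡ apps M (V ++ W)
apps-++ M []      W = refl
apps-++ M (E ∷ V) W = apps-++ (app M E) V W

-- Both sides collapse to one substitution. `sub-sub` needs such commutations with weakening under
-- binders, which is why the two mixed composition laws precede it.
subI-renI : ∀ {τ θ} M →
            sub (liftI τ) (renC suc id ∘ θ) (ren suc id M) ≡ ren suc id (sub τ θ M)
subI-renI M = trans (sub-ren (λ _ → refl) (λ _ → refl) M)
                    (sym (ren-sub (λ _ → refl) (λ _ → refl) M))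

subC-renC : ∀ {τ θ} M →
            sub (ren id suc ∘ τ) (liftC θ) (ren id suc M) ≡ ren id suc (sub τ θ M)
subC-renC M = trans (sub-ren (λ _ → refl) (λ _ → refl) M)
                    (sym (ren-sub (λ _ → refl) (λ _ → refl) M))

subEI-renEI : ∀ {τ θ} E →
              subE (liftI τ) (renC suc id ∘ θ) (renE suc id E) ≡ renE suc id (subE τ θ E)
subEI-renEI E = trans (subE-renE (λ _ → refl) (λ _ → refl) E)
                      (sym (renE-subE (λ _ → refl) (λ _ → refl) E))

subEC-renEC : ∀ {τ θ} E →
              subE (ren id suc ∘ τ) (liftC θ) (renE id suc E) ≡ renE id suc (subE τ θ E)
subEC-renEC E = trans (subE-renE (λ _ → refl) (λ _ → refl) E)
                      (sym (renE-subE (λ _ → refl) (λ _ → refl) E))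

map-swap-++ : {f g f′ g′ : Elim → Elim} → f ∘ g ≗ f′ ∘ g′ → ∀ V W →
              map f (map g V) ++ map f′ W ≡ map f′ (map g′ V ++ W)
map-swap-++ {f′ = f′} {g′} eq V W =
  trans (cong (_++ map f′ W) (map-swap eq V)) (sym (map-++ f′ (map g′ V) W))

sub-liftI : ∀ {τ₁ τ θ τ′} → sub τ θ ∘ τ₁ ≗ τ′ →
            sub (liftI τ) (renC suc id ∘ θ) ∘ liftI τ₁ ≗ liftI τ′
sub-liftI           p zero    = refl
sub-liftI {τ₁ = τ₁} p (suc x) = trans (subI-renI (τ₁ x)) (cong (ren suc id) (p x))

subC-underI : ∀ (θ₁ : ℕ → Cov) {τ} θ {θ′} → subC τ θ ∘ θ₁ ≗ θ′ →
              subC (liftI τ) (renC suc id ∘ θ) ∘ (renC suc id ∘ θ₁) ≗ renC suc id ∘ θ′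
subC-underI θ₁ θ q a =
  trans (cov (map-swap-++ subEI-renEI (proj₂ (θ₁ a)) (proj₂ (θ (proj₁ (θ₁ a))))))
        (cong (renC suc id) (q a))

sub-liftC : ∀ θ₁ {τ} θ {θ′} → subC τ θ ∘ θ₁ ≗ θ′ →
            subC (ren id suc ∘ τ) (liftC θ) ∘ liftC θ₁ ≗ liftC θ′
sub-liftC θ₁ θ q zero    = refl
sub-liftC θ₁ θ q (suc a) =
  trans (cov (map-swap-++ subEC-renEC (proj₂ (θ₁ a)) (proj₂ (θ (proj₁ (θ₁ a))))))
        (cong (renC id suc) (q a))

mutual
  sub-sub : ∀ {τ₁ θ₁ τ θ τ′ θ′} → sub τ θ ∘ τ₁ ≗ τ′ → subC τ θ ∘ θ₁ ≗ θ′ →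
            ∀ M → sub τ θ (sub τ₁ θ₁ M) ≡ sub τ′ θ′ M
  sub-sub p q (var x)    = p x
  sub-sub {θ₁ = θ₁} {θ = θ} p q (lam M)    = cong lam (sub-sub (sub-liftI p) (subC-underI θ₁ θ q) M)
  sub-sub p q (app M E)  = cong₂ app (sub-sub p q M) (subE-subE p q E)
  sub-sub p q (pair M N) = cong₂ pair (sub-sub p q M) (sub-sub p q N)
  sub-sub p q (ω₁ M)     = cong ω₁ (sub-sub p q M)
  sub-sub p q (ω₂ M)     = cong ω₂ (sub-sub p q M)
  sub-sub {τ₁} {θ₁} {θ = θ} p q (mu M) =
    cong mu (sub-sub (λ x → trans (subC-renC (τ₁ x)) (cong (ren id suc) (p x))) (sub-liftC θ₁ θ q) M)
  sub-sub {θ₁ = θ₁} {τ} {θ} p q (capp a M) =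
    -- The argument meets the substituted `V`, then the stack `W` of the new variable; `apps-++`
    -- joins them into the stack computed by `subC`.
    trans (cong (capp _)
            (trans (cong (λ N → apps N W) (sub-apps _ V)) (apps-++ _ (map (subE τ θ) V) W)))
          (cong₂ (λ c N → capp (proj₁ c) (apps N (proj₂ c))) (q a) (sub-sub p q M))
    where
    V = proj₂ (θ₁ a)
    W = proj₂ (θ (proj₁ (θ₁ a)))

  subE-subE : ∀ {τ₁ θ₁ τ θ τ′ θ′} → sub τ θ ∘ τ₁ ≗ τ′ → subC τ θ ∘ θ₁ ≗ θ′ →
              ∀ E → subE τ θ (subE τ₁ θ₁ E) ≡ subE τ′ θ′ E
  subE-subE p q (tm M)       = cong tm (sub-sub p q M)
  subE-subE p q π₁           = refl
  subE-subE p q π₂           = refl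
  subE-subE {θ₁ = θ₁} {θ = θ} p q (case N₁ N₂) =
    cong₂ case (sub-sub (sub-liftI p) (subC-underI θ₁ θ q) N₁)
               (sub-sub (sub-liftI p) (subC-underI θ₁ θ q) N₂)

liftI-id : ∀ {τ} → τ ≗ var → liftI τ ≗ var
liftI-id p zero    = refl
liftI-id p (suc x) = cong (ren suc id) (p x)

liftC-id : ∀ {θ} → θ ≗ idC → liftC θ ≗ idC
liftC-id q zero    = refl
liftC-id q (suc a) = cong (renC id suc) (q a)

mutual
  sub-id : ∀ {τ θ} → τ ≗ var → θ ≗ idC → ∀ M → sub τ θ M ≡ M
  sub-id p q (var x)    = p x
  sub-id p q (lam M)    = cong lam (sub-id (liftI-id p) (cong (renC suc id) ∘ q) M)
  sub-id p q (app M E)  = cong₂ app (sub-id p q M) (subE-id p q E)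
  sub-id p q (pair M N) = cong₂ pair (sub-id p q M) (sub-id p q N)
  sub-id p q (ω₁ M)     = cong ω₁ (sub-id p q M)
  sub-id p q (ω₂ M)     = cong ω₂ (sub-id p q M)
  sub-id p q (mu M)     = cong mu (sub-id (cong (ren id suc) ∘ p) (liftC-id q) M)
  sub-id p q (capp a M) =
    cong₂ (λ c N → capp (proj₁ c) (apps N (proj₂ c))) (q a) (sub-id p q M)

  subE-id : ∀ {τ θ} → τ ≗ var → θ ≗ idC → ∀ E → subE τ θ E ≡ E
  subE-id p q (tm M)       = cong tm (sub-id p q M)
  subE-id p q π₁           = refl
  subE-id p q π₂           = refl
  subE-id p q (case N₁ N₂) =
    cong₂ case (sub-id (liftI-id p) (cong (renC suc id) ∘ q) N₁)
               (sub-id (liftI-id p) (cong (renC suc id) ∘ q) N₂)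

-- Shifts and substitutions as simultaneous substitutions

bump : ℕ → ℕ → ℕ
bump c x = if x <ᵇ c then x else suc x

-- Passing a binder raises the cutoff of a shift, which is exactly lifting its action on indices;
-- hence shifts are renamings at every cutoff.
lift-bump : ∀ {c ρ} → bump c ≗ ρ → bump (suc c) ≗ lift ρ
lift-bump     p zero    = refl
lift-bump {c} p (suc x) with x <ᵇ c | p x
... | true  | eq = cong suc eq
... | false | eq = cong suc eq

lift-id : ∀ {ρ} → id ≗ ρ → id ≗ lift ρ
lift-id p zero    = refl
lift-id p (suc x) = cong suc (p x)

mutual
  shiftI-ren : ∀ {c ρ κ} → bump c ≗ ρ → id ≗ κ → ∀ M → shiftI c M ≡ ren ρ κ M
  shiftI-ren {c} p q (var x) with x <ᵇ c | p x
  ... | true  | eq = cong var eq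
  ... | false | eq = cong var eq
  shiftI-ren p q (lam M)    = cong lam (shiftI-ren (lift-bump p) q M)
  shiftI-ren p q (app M E)  = cong₂ app (shiftI-ren p q M) (shiftIE-ren p q E)
  shiftI-ren p q (pair M N) = cong₂ pair (shiftI-ren p q M) (shiftI-ren p q N)
  shiftI-ren p q (ω₁ M)     = cong ω₁ (shiftI-ren p q M)
  shiftI-ren p q (ω₂ M)     = cong ω₂ (shiftI-ren p q M)
  shiftI-ren p q (mu M)     = cong mu (shiftI-ren p (lift-id q) M)
  shiftI-ren p q (capp a M) = cong₂ capp (q a) (shiftI-ren p q M)

  shiftIE-ren : ∀ {c ρ κ} → bump c ≗ ρ → id ≗ κ → ∀ E → shiftIE c E ≡ renE ρ κ E
  shiftIE-ren p q (tm M)       = cong tm (shiftI-ren p q M)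
  shiftIE-ren p q π₁           = refl
  shiftIE-ren p q π₂           = refl
  shiftIE-ren p q (case N₁ N₂) =
    cong₂ case (shiftI-ren (lift-bump p) q N₁) (shiftI-ren (lift-bump p) q N₂)

mutual
  shiftC-ren : ∀ {c ρ κ} → id ≗ ρ → bump c ≗ κ → ∀ M → shiftC c M ≡ ren ρ κ M
  shiftC-ren p q (var x)    = cong var (p x)
  shiftC-ren p q (lam M)    = cong lam (shiftC-ren (lift-id p) q M)
  shiftC-ren p q (app M E)  = cong₂ app (shiftC-ren p q M) (shiftCE-ren p q E)
  shiftC-ren p q (pair M N) = cong₂ pair (shiftC-ren p q M) (shiftC-ren p q N)
  shiftC-ren p q (ω₁ M)     = cong ω₁ (shiftC-ren p q M)
  shiftC-ren p q (ω₂ M)     = cong ω₂ (shiftC-ren p q M)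
  shiftC-ren p q (mu M)     = cong mu (shiftC-ren p (lift-bump q) M)
  shiftC-ren p q (capp a M) = cong₂ capp (q a) (shiftC-ren p q M)

  shiftCE-ren : ∀ {c ρ κ} → id ≗ ρ → bump c ≗ κ → ∀ E → shiftCE c E ≡ renE ρ κ E
  shiftCE-ren p q (tm M)       = cong tm (shiftC-ren p q M)
  shiftCE-ren p q π₁           = refl
  shiftCE-ren p q π₂           = refl
  shiftCE-ren p q (case N₁ N₂) =
    cong₂ case (shiftC-ren (lift-id p) q N₁) (shiftC-ren (lift-id p) q N₂)

shiftI₀ : ∀ M → shiftI 0 M ≡ ren suc id M
shiftI₀ = shiftI-ren (λ _ → refl) (λ _ → refl)

shiftIE₀ : ∀ E → shiftIE 0 E ≡ renE suc id E
shiftIE₀ = shiftIE-ren (λ _ → refl) (λ _ → refl)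

shiftC₀ : ∀ M → shiftC 0 M ≡ ren id suc M
shiftC₀ = shiftC-ren (λ _ → refl) (λ _ → refl)

shiftCE₀ : ∀ E → shiftCE 0 E ≡ renE id suc E
shiftCE₀ = shiftCE-ren (λ _ → refl) (λ _ → refl)

substVar : ℕ → Term → ℕ → Term
substVar k N x = substI k N (var x)

substVar-liftI : ∀ {k N τ} → substVar k N ≗ τ → substVar (suc k) (shiftI 0 N) ≗ liftI τ
substVar-liftI p zero = refl
substVar-liftI {k} {N} p (suc x) = trans (lemma k x) (cong (ren suc id) (p x))
  where
  -- Weakening undoes `pred` only for positive x, hence the split on x; at x = 0 one of the two
  -- tests succeeds.
  lemma : ∀ k x → substVar (suc k) (shiftI 0 N) (suc x) ≡ ren suc id (substVar k N x)
  lemma zero    zero    = shiftI₀ N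
  lemma zero    (suc x) = refl
  lemma (suc k) zero    = refl
  lemma (suc k) (suc x) with x <ᵇ k
  ... | true = refl
  ... | false with x ≡ᵇ k
  ...   | true  = shiftI₀ N
  ...   | false = refl

substVar-shiftC : ∀ {k N τ} → substVar k N ≗ τ → substVar k (shiftC 0 N) ≗ ren id suc ∘ τ
substVar-shiftC {k} {N} p x = trans lemma (cong (ren id suc) (p x))
  where
  lemma : substVar k (shiftC 0 N) x ≡ ren id suc (substVar k N x)
  lemma with x <ᵇ k
  ... | true = refl
  ... | false with x ≡ᵇ k
  ...   | true  = shiftC₀ N
  ...   | false = refl

idC-liftC : ∀ {θ} → idC ≗ θ → idC ≗ liftC θ
idC-liftC q a = sym (liftC-id (λ b → sym (q b)) a)

mutual
  substI-sub : ∀ {k N τ θ} → substVar k N ≗ τ → idC ≗ θ → ∀ M → substI k N M ≡ sub τ θ M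
  substI-sub p q (var x)    = p x
  substI-sub p q (lam M)    =
    cong lam (substI-sub (substVar-liftI p) (cong (renC suc id) ∘ q) M)
  substI-sub p q (app M E)  = cong₂ app (substI-sub p q M) (substIE-sub p q E)
  substI-sub p q (pair M N) = cong₂ pair (substI-sub p q M) (substI-sub p q N)
  substI-sub p q (ω₁ M)     = cong ω₁ (substI-sub p q M)
  substI-sub p q (ω₂ M)     = cong ω₂ (substI-sub p q M)
  substI-sub {k} {N} p q (mu M) = cong mu (substI-sub (substVar-shiftC {k} {N} p) (idC-liftC q) M)
  substI-sub p q (capp a M) =
    cong₂ (λ c N → capp (proj₁ c) (apps N (proj₂ c))) (q a) (substI-sub p q M)

  substIE-sub : ∀ {k N τ θ} → substVar k N ≗ τ → idC ≗ θ → ∀ E → substIE k N E ≡ subE τ θ E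
  substIE-sub p q (tm M)       = cong tm (substI-sub p q M)
  substIE-sub p q π₁           = refl
  substIE-sub p q π₂           = refl
  substIE-sub p q (case N₁ N₂) =
    cong₂ case (substI-sub (substVar-liftI p) (cong (renC suc id) ∘ q) N₁)
               (substI-sub (substVar-liftI p) (cong (renC suc id) ∘ q) N₂)

ssubCov : ℕ → Elim → ℕ → Cov
ssubCov a E b = if b ≡ᵇ a then (b , E ∷ []) else (b , [])

ssubCov-shiftI : ∀ {a E θ} → ssubCov a E ≗ θ → ssubCov a (shiftIE 0 E) ≗ renC suc id ∘ θ
ssubCov-shiftI {a} {E} q b = trans lemma (cong (renC suc id) (q b))
  where
  lemma : ssubCov a (shiftIE 0 E) b ≡ renC suc id (ssubCov a E b)
  lemma with b ≡ᵇ a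
  ... | true  = cong (λ F → b , F ∷ []) (shiftIE₀ E)
  ... | false = refl

ssubCov-liftC : ∀ {a E θ} → ssubCov a E ≗ θ → ssubCov (suc a) (shiftCE 0 E) ≗ liftC θ
ssubCov-liftC         q zero    = refl
ssubCov-liftC {a} {E} q (suc b) = trans lemma (cong (renC id suc) (q b))
  where
  lemma : ssubCov (suc a) (shiftCE 0 E) (suc b) ≡ renC id suc (ssubCov a E b)
  lemma with b ≡ᵇ a
  ... | true  = cong (λ F → suc b , F ∷ []) (shiftCE₀ E)
  ... | false = refl

mutual
  ssub-sub : ∀ {a E τ θ} → var ≗ τ → ssubCov a E ≗ θ → ∀ M → ssub a E M ≡ sub τ θ M
  ssub-sub p q (var x)    = p x
  ssub-sub p q (lam M)    = cong lam (ssub-sub (var-liftI p) (ssubCov-shiftI q) M)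
  ssub-sub p q (app M E)  = cong₂ app (ssub-sub p q M) (ssubE-sub p q E)
  ssub-sub p q (pair M N) = cong₂ pair (ssub-sub p q M) (ssub-sub p q N)
  ssub-sub p q (ω₁ M)     = cong ω₁ (ssub-sub p q M)
  ssub-sub p q (ω₂ M)     = cong ω₂ (ssub-sub p q M)
  ssub-sub p q (mu M)     =
    cong mu (ssub-sub (cong (ren id suc) ∘ p) (ssubCov-liftC q) M)
  ssub-sub {a} p q (capp b M) with b ≡ᵇ a | q b
  ... | true  | eq = cong₂ (λ c N → capp (proj₁ c) (apps N (proj₂ c))) eq (ssub-sub p q M)
  ... | false | eq = cong₂ (λ c N → capp (proj₁ c) (apps N (proj₂ c))) eq (ssub-sub p q M)

  ssubE-sub : ∀ {a E τ θ} → var ≗ τ → ssubCov a E ≗ θ → ∀ F → ssubE a E F ≡ subE τ θ F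
  ssubE-sub p q (tm M)       = cong tm (ssub-sub p q M)
  ssubE-sub p q π₁           = refl
  ssubE-sub p q π₂           = refl
  ssubE-sub p q (case N₁ N₂) =
    cong₂ case (ssub-sub (var-liftI p) (ssubCov-shiftI q) N₁)
               (ssub-sub (var-liftI p) (ssubCov-shiftI q) N₂)

  var-liftI : ∀ {τ} → var ≗ τ → var ≗ liftI τ
  var-liftI p x = sym (liftI-id (λ y → sym (p y)) x)

-- Equations for instantiating a bound variable.

map-map-[] : {f g h : Elim → Elim} → f ∘ g ≗ h → ∀ V → map f (map g V) ++ [] ≡ map h V
map-map-[] eq V = trans (++-identityʳ _) (trans (sym (map-∘ V)) (map-cong eq V))

substI₀ : ∀ P M → substI 0 P M ≡ sub (P • var) idC M
substI₀ P = substI-sub (λ { zero → refl ; (suc x) → refl }) (λ _ → refl)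

sub-substI : ∀ {τ θ} N M → sub τ θ (substI 0 N M) ≡ sub (sub τ θ N • τ) θ M
sub-substI {τ} {θ} N M =
  trans (cong (sub τ θ) (substI₀ N M))
        (sub-sub (λ { zero → refl ; (suc x) → refl }) (λ _ → refl) M)

-- The images of `τ` and `θ` were weakened on entering the binder, and putting `P` for index 0
-- cancels this. Reducibility of λ and of case branches rests on it.
substI-subI : ∀ {τ} θ P M →
              substI 0 P (sub (liftI τ) (renC suc id ∘ θ) M) ≡ sub (P • τ) θ M
substI-subI {τ} θ P M =
  trans (substI₀ P (sub (liftI τ) (renC suc id ∘ θ) M))
        (sub-sub (λ { zero → refl ; (suc x) → cancel (τ x) })
                 (λ a → cov (trans (map-map-[] cancelE (proj₂ (θ a))) (map-id _))) M)
  where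
  cancel : ∀ N → sub (P • var) idC (ren suc id N) ≡ N
  cancel N = trans (sub-ren (λ _ → refl) (λ _ → refl) N) (sub-id (λ _ → refl) (λ _ → refl) N)
  cancelE : ∀ E → subE (P • var) idC (renE suc id E) ≡ E
  cancelE E = trans (subE-renE (λ _ → refl) (λ _ → refl) E) (subE-id (λ _ → refl) (λ _ → refl) E)

substIE-shiftIE : ∀ P E → substIE 0 P (shiftIE 0 E) ≡ E
substIE-shiftIE P E = begin
  substIE 0 P (shiftIE 0 E)             ≡⟨ substIE-sub (λ { zero → refl ; (suc x) → refl }) (λ _ → refl) (shiftIE 0 E) ⟩
  subE (P • var) idC (shiftIE 0 E)      ≡⟨ cong (subE (P • var) idC) (shiftIE₀ E) ⟩
  subE (P • var) idC (renE suc id E)    ≡⟨ subE-renE (λ _ → refl) (λ _ → refl) E ⟩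
  subE var idC E                        ≡⟨ subE-id (λ _ → refl) (λ _ → refl) E ⟩
  E                                     ∎
  where open ≡-Reasoning

-- Stands for M[a:=*V] followed by renaming a to 0.  That renaming may identify
-- a with another classical variable, which is harmless: only SN of the result
-- is used, and substitution reflects SN.
instC : List Elim → Term → Term
instC V = sub var ((0 , V) • idC)

module _ {V : List Elim} where
  instC-renC : ∀ N → instC V (ren id suc N) ≡ N
  instC-renC N =
    trans (sub-ren (λ _ → refl) (λ _ → refl) N) (sub-id (λ _ → refl) (λ _ → refl) N)

  instCE-renEC : ∀ E → subE var ((0 , V) • idC) (renE id suc E) ≡ E
  instCE-renEC E =
    trans (subE-renE (λ _ → refl) (λ _ → refl) E) (subE-id (λ _ → refl) (λ _ → refl) E)

  -- The counterpart of `substI-subI` for μ: the bound classical variable receives `V`, and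
  -- elsewhere instantiation cancels the weakening.
  instC-subC : ∀ {τ} θ M →
               instC V (sub (ren id suc ∘ τ) (liftC θ) M) ≡ sub τ ((0 , V) • θ) M
  instC-subC {τ} θ M = sub-sub (instC-renC ∘ τ) images M
    where
    images : subC var ((0 , V) • idC) ∘ liftC θ ≗ (0 , V) • θ
    images zero    = refl
    images (suc a) = cov (trans (map-map-[] instCE-renEC (proj₂ (θ a))) (map-id _))

  -- The μ-step puts `E` next to each argument of the bound variable, and instantiation then adds
  -- `V` behind it. As `E` is weakened, instantiation gives it back intact.
  instC-ssub : ∀ E M → instC V (ssub 0 (shiftCE 0 E) M) ≡ instC (E ∷ V) M
  instC-ssub E M =
    trans (cong (instC V) (ssub-sub (λ _ → refl) (λ _ → refl) M)) (sub-sub (λ _ → refl) images M)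
    where
    images : subC var ((0 , V) • idC) ∘ ssubCov 0 (shiftCE 0 E) ≗ (0 , E ∷ V) • idC
    images zero    =
      cov (cong (_∷ V) (trans (cong (subE var ((0 , V) • idC)) (shiftCE₀ E)) (instCE-renEC E)))
    images (suc a) = refl

ren-as-sub : ∀ {ρ κ} M → ren ρ κ M ≡ sub (var ∘ ρ) (idC ∘ κ) M
ren-as-sub {ρ} {κ} M = trans (cong (ren ρ κ) (sym (sub-id (λ _ → refl) (λ _ → refl) M)))
                     (ren-sub (λ _ → refl) (λ _ → refl) M)

renE-as-subE : ∀ {ρ κ} E → renE ρ κ E ≡ subE (var ∘ ρ) (idC ∘ κ) E
renE-as-subE {ρ} {κ} E = trans (cong (renE ρ κ) (sym (subE-id (λ _ → refl) (λ _ → refl) E)))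
                       (renE-subE (λ _ → refl) (λ _ → refl) E)

-- Both sides are the substitution `θ′` below. The lifted images of `τ` and `θ` are weakened, so the
-- bound variable is absent from them and structural substitution passes over them.
sub-ssub : ∀ {τ θ} E M →
           sub (ren id suc ∘ τ) (liftC θ) (ssub 0 (shiftCE 0 E) M) ≡
           ssub 0 (shiftCE 0 (subE τ θ E)) (sub (ren id suc ∘ τ) (liftC θ) M)
sub-ssub {τ} {θ} E M = begin
  sub τ↑ (liftC θ) (ssub 0 (shiftCE 0 E) M)             ≡⟨ cong (sub τ↑ (liftC θ)) (ssub-sub (λ _ → refl) (λ _ → refl) M) ⟩
  sub τ↑ (liftC θ) (sub var (ssubCov 0 (shiftCE 0 E)) M) ≡⟨ sub-sub (λ _ → refl) imagesˡ M ⟩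
  sub τ↑ θ′ M                                           ≡⟨ sym (sub-sub (weaken ∘ τ) imagesʳ M) ⟩
  sub var (ssubCov 0 F) (sub τ↑ (liftC θ) M)            ≡⟨ sym (ssub-sub (λ _ → refl) (λ _ → refl) (sub τ↑ (liftC θ) M)) ⟩
  ssub 0 F (sub τ↑ (liftC θ) M)                         ∎
  where
  open ≡-Reasoning
  τ↑ : ℕ → Term
  τ↑ = ren id suc ∘ τ
  F : Elim
  F = shiftCE 0 (subE τ θ E)
  θ′ : ℕ → Cov
  θ′ = (0 , F ∷ []) • (renC id suc ∘ θ)
  imagesˡ : subC τ↑ (liftC θ) ∘ ssubCov 0 (shiftCE 0 E) ≗ θ′
  imagesˡ zero    = cov (cong (_∷ []) (trans (cong (subE τ↑ (liftC θ)) (shiftCE₀ E))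
                                      (trans (subEC-renEC E) (sym (shiftCE₀ (subE τ θ E))))))
  imagesˡ (suc a) = refl
  weaken : ∀ N → sub var (ssubCov 0 F) (ren id suc N) ≡ ren id suc N
  weaken N = trans (sub-ren (λ _ → refl) (λ _ → refl) N) (sym (ren-as-sub N))
  weakenE : ∀ G → subE var (ssubCov 0 F) (renE id suc G) ≡ renE id suc G
  weakenE G = trans (subE-renE (λ _ → refl) (λ _ → refl) G) (sym (renE-as-subE G))
  imagesʳ : subC var (ssubCov 0 F) ∘ liftC θ ≗ θ′
  imagesʳ zero    = refl
  imagesʳ (suc a) = cov (map-map-[] weakenE (proj₂ (θ a)))

-- Reduction under substitution

apps-▷ˡ : ∀ {M M′} V → M ▷ M′ → apps M V ▷ apps M′ V
apps-▷ˡ []      r = r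
apps-▷ˡ (E ∷ V) r = apps-▷ˡ V (c-appˡ r)

subE-shiftIE : ∀ {τ θ} E →
               subE (liftI τ) (renC suc id ∘ θ) (shiftIE 0 E) ≡ shiftIE 0 (subE τ θ E)
subE-shiftIE {τ} {θ} E =
  trans (cong (subE (liftI τ) (renC suc id ∘ θ)) (shiftIE₀ E))
        (trans (subEI-renEI E) (sym (shiftIE₀ (subE τ θ E))))

substI-sub-comm : ∀ {τ θ} N M →
  substI 0 (sub τ θ N) (sub (liftI τ) (renC suc id ∘ θ) M) ≡ sub τ θ (substI 0 N M)
substI-sub-comm {τ} {θ} N M = trans (substI-subI θ (sub τ θ N) M) (sym (sub-substI N M))

▷-resp : ∀ {M N N′} → N ≡ N′ → M ▷ N → M ▷ N′
▷-resp refl r = r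

mutual
  -- A redex stays a redex: substitution replaces variables and adds stacks only around arguments of
  -- classical variables, which form no redex with them.
  sub-▷ : ∀ {τ θ M M′} → M ▷ M′ → sub τ θ M ▷ sub τ θ M′
  sub-▷ (β {M} {N})        = ▷-resp (substI-sub-comm N M) β
  sub-▷ π₁β                = π₁β
  sub-▷ π₂β                = π₂β
  sub-▷ (ω₁β {M} {N₁})     = ▷-resp (substI-sub-comm M N₁) ω₁β
  sub-▷ (ω₂β {M} {_} {N₂}) = ▷-resp (substI-sub-comm M N₂) ω₂β
  sub-▷ (perm {M} {N₁} {N₂} {E}) =
    ▷-resp (cong (λ F → app _ (case (app _ F) (app _ F))) (sym (subE-shiftIE E))) perm
  sub-▷ (μβ {M} {E})       = ▷-resp (cong mu (sym (sub-ssub E M))) μβ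
  sub-▷ (c-lam r)          = c-lam (sub-▷ r)
  sub-▷ (c-appˡ r)         = c-appˡ (sub-▷ r)
  sub-▷ (c-appʳ r)         = c-appʳ (subE-▷ r)
  sub-▷ (c-pairˡ r)        = c-pairˡ (sub-▷ r)
  sub-▷ (c-pairʳ r)        = c-pairʳ (sub-▷ r)
  sub-▷ (c-ω₁ r)           = c-ω₁ (sub-▷ r)
  sub-▷ (c-ω₂ r)           = c-ω₂ (sub-▷ r)
  sub-▷ (c-mu r)           = c-mu (sub-▷ r)
  sub-▷ {θ = θ} (c-capp {a} r) = c-capp (apps-▷ˡ (proj₂ (θ a)) (sub-▷ r))

  subE-▷ : ∀ {τ θ E E′} → E ▷ₑ E′ → subE τ θ E ▷ₑ subE τ θ E′
  subE-▷ (c-tm r)    = c-tm (sub-▷ r)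
  subE-▷ (c-caseˡ r) = c-caseˡ (sub-▷ r)
  subE-▷ (c-caseʳ r) = c-caseʳ (sub-▷ r)

substI-▷ : ∀ {P M M′} → M ▷ M′ → substI 0 P M ▷ substI 0 P M′
substI-▷ {P} {M} {M′} r
  rewrite substI₀ P M | substI₀ P M′ = sub-▷ r

-- Each step of `M` becomes exactly one step of its instance, so an infinite reduction would carry
-- over.
SN-sub⁻ : ∀ {τ θ M} → SN (sub τ θ M) → SN M
SN-sub⁻ (acc rs) = acc λ r → SN-sub⁻ (rs (sub-▷ r))

-- Stacks

infix 4 _▷ₛ_
data _▷ₛ_ : List Elim → List Elim → Set where
  elim  : ∀ {E E′ V} → E ▷ₑ E′ → E ∷ V ▷ₛ E′ ∷ V
  tail  : ∀ {E V V′} → V ▷ₛ V′ → E ∷ V ▷ₛ E ∷ V′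
  merge : ∀ {N₁ N₂ E V} →
          case N₁ N₂ ∷ E ∷ V ▷ₛ case (app N₁ (shiftIE 0 E)) (app N₂ (shiftIE 0 E)) ∷ V

SNₛ : List Elim → Set
SNₛ = Acc (flip _▷ₛ_)

apps-▷ʳ : ∀ {M V V′} → V ▷ₛ V′ → apps M V ▷ apps M V′
apps-▷ʳ (elim {V = V} r)  = apps-▷ˡ V (c-appʳ r)
apps-▷ʳ (tail r)          = apps-▷ʳ r
apps-▷ʳ (merge {V = V})   = apps-▷ˡ V perm

length-▷ₛ : ∀ {V V′} → V ▷ₛ V′ → length V′ ≤ length V
length-▷ₛ (elim r) = ≤-refl
length-▷ₛ (tail r) = s≤s (length-▷ₛ r)
length-▷ₛ merge    = n≤1+n _

-- Reducts of a term applied to a stack.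

data Cut : Term → Elim → Term → Set where
  cut-β    : ∀ {M N} → Cut (lam M) (tm N) (substI 0 N M)
  cut-π₁   : ∀ {M N} → Cut (pair M N) π₁ M
  cut-π₂   : ∀ {M N} → Cut (pair M N) π₂ N
  cut-ω₁   : ∀ {M N₁ N₂} → Cut (ω₁ M) (case N₁ N₂) (substI 0 M N₁)
  cut-ω₂   : ∀ {M N₁ N₂} → Cut (ω₂ M) (case N₁ N₂) (substI 0 M N₂)
  cut-perm : ∀ {M N₁ N₂ E} → Cut (app M (case N₁ N₂)) E
               (app M (case (app N₁ (shiftIE 0 E)) (app N₂ (shiftIE 0 E))))
  cut-μ    : ∀ {M E} → Cut (mu M) E (mu (ssub 0 (shiftCE 0 E) M))

data AppsStep (M : Term) : List Elim → Term → Set where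
  head  : ∀ {M′ V} → M ▷ M′ → AppsStep M V (apps M′ V)
  stack : ∀ {V V′} → V ▷ₛ V′ → AppsStep M V (apps M V′)
  cut   : ∀ {E V R} → Cut M E R → AppsStep M (E ∷ V) (apps R V)

-- The recursive call takes `app M E` as the head. A step of that head is one of `M`, one of `E`, or
-- an interaction of the two.
apps-step : ∀ {M T} V → apps M V ▷ T → AppsStep M V T
apps-step []      r = head r
apps-step (E ∷ V) r with apps-step V r
... | head β           = cut cut-β
... | head π₁β         = cut cut-π₁
... | head π₂β         = cut cut-π₂
... | head ω₁β         = cut cut-ω₁
... | head ω₂β         = cut cut-ω₂
... | head perm        = cut cut-perm
... | head μβ          = cut cut-μ
... | head (c-appˡ r′) = head r′
... | head (c-appʳ r′) = stack (elim r′)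
... | stack s          = stack (tail s)
-- An application meets the next eliminator only by permutation; then `E` is a case and the
-- conversion already lies in the stack.
... | cut cut-perm     = stack merge

-- A variable is normal and takes part in no cut, so all reduction happens in the stack.
var-SN : ∀ {x V} → SNₛ V → SN (apps (var x) V)
var-SN {x} {V} (acc rs) = acc (step ∘ apps-step V)
  where
  step : ∀ {T} → AppsStep (var x) V T → SN T
  step (stack s) = var-SN (rs s)

-- Strong normalisation of stacks.

[]-SNₛ : SNₛ []
[]-SNₛ = acc λ ()

tm-SNₛ : ∀ {P V} → SN P → SNₛ V → SNₛ (tm P ∷ V)
tm-SNₛ (acc p) (acc v) = acc λ where
  (elim (c-tm r)) → tm-SNₛ (p r) (acc v)
  (tail s)        → tm-SNₛ (acc p) (v s)

π₁-SNₛ : ∀ {V} → SNₛ V → SNₛ (π₁ ∷ V)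
π₁-SNₛ (acc v) = acc λ { (tail s) → π₁-SNₛ (v s) }

π₂-SNₛ : ∀ {V} → SNₛ V → SNₛ (π₂ ∷ V)
π₂-SNₛ (acc v) = acc λ { (tail s) → π₂-SNₛ (v s) }

tail-SNₛ : ∀ {E V} → SNₛ (E ∷ V) → SNₛ V
tail-SNₛ (acc rs) = acc λ s → tail-SNₛ (rs (tail s))

-- The branch variable does not occur in the shifted `E`, so (N E)[x:=P] V and N[x:=P] E V are the
-- same term.
SN-merge : ∀ P N E V → SN (apps (substI 0 P N) (E ∷ V)) →
           SN (apps (substI 0 P (app N (shiftIE 0 E))) V)
SN-merge P N E V = subst (λ F → SN (apps (app _ F) V)) (sym (substIE-shiftIE P E))

mutual
  -- One instance of each branch is enough. The induction is lexicographic on `n` and the two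
  -- accessibility proofs; `n` only bounds the length, since a step in `V` may shorten it.
  case-SNₛ : ∀ n {P₁ P₂ N₁ N₂ V} → length V ≤ n →
             SN (apps (substI 0 P₁ N₁) V) → SN (apps (substI 0 P₂ N₂) V) →
             SNₛ (case N₁ N₂ ∷ V)
  case-SNₛ n l s₁ s₂ = acc (case-step n l s₁ s₂)

  case-step : ∀ n {P₁ P₂ N₁ N₂ V W} → length V ≤ n →
              SN (apps (substI 0 P₁ N₁) V) → SN (apps (substI 0 P₂ N₂) V) →
              case N₁ N₂ ∷ V ▷ₛ W → SNₛ W
  case-step n {V = V} l (acc s₁) s₂ (elim (c-caseˡ r)) =
    case-SNₛ n l (s₁ (apps-▷ˡ V (substI-▷ r))) s₂
  case-step n {V = V} l s₁ (acc s₂) (elim (c-caseʳ r)) =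
    case-SNₛ n l s₁ (s₂ (apps-▷ˡ V (substI-▷ r)))
  case-step n l (acc s₁) (acc s₂) (tail r) =
    case-SNₛ n (≤-trans (length-▷ₛ r) l) (s₁ (apps-▷ʳ r)) (s₂ (apps-▷ʳ r))
  -- Merging leaves both instances the same terms, so no accessibility proof decreases; the shorter
  -- stack does.
  case-step (suc n) {P₁} {P₂} (s≤s l) s₁ s₂ (merge {N₁} {N₂} {E} {V}) =
    case-SNₛ n {P₁} {P₂} l (SN-merge P₁ N₁ E V s₁) (SN-merge P₂ N₂ E V s₂)

capp-SN : ∀ {a M} → SN M → SN (capp a M)
capp-SN (acc m) = acc λ { (c-capp r) → capp-SN (m r) }

-- Reducibility

Orth : (List Elim → Set) → Term → Set
Orth K M = ∀ {V} → K V → SN (apps M V)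

-- Abstracting over predicates lets `Cont` recurse on the formula. One inductive family indexed by
-- formulas would not be strictly positive, because `Orth` puts `Cont A` left of an arrow.
data ⇒-Cont (R : Term → Set) (K : List Elim → Set) : List Elim → Set where
  nil : ⇒-Cont R K []
  arg : ∀ {P V} → R P → K V → ⇒-Cont R K (tm P ∷ V)

data ∧-Cont (K₁ K₂ : List Elim → Set) : List Elim → Set where
  nil : ∧-Cont K₁ K₂ []
  fst : ∀ {V} → K₁ V → ∧-Cont K₁ K₂ (π₁ ∷ V)
  snd : ∀ {V} → K₂ V → ∧-Cont K₁ K₂ (π₂ ∷ V)

data ∨-Cont (R₁ R₂ : Term → Set) : List Elim → Set where
  nil    : ∨-Cont R₁ R₂ []
  branch : ∀ {N₁ N₂ V} →
           (∀ {P} → R₁ P → SN (apps (substI 0 P N₁) V)) →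
           (∀ {P} → R₂ P → SN (apps (substI 0 P N₂) V)) →
           ∨-Cont R₁ R₂ (case N₁ N₂ ∷ V)

Cont : Form → List Elim → Set
Cont (atom _) V = V ≡ []
Cont ⊥′       V = V ≡ []
Cont (A ⇒ B)    = ⇒-Cont (Orth (Cont A)) (Cont B)
Cont (A ∧ B)    = ∧-Cont (Cont A) (Cont B)
Cont (A ∨ B)    = ∨-Cont (Orth (Cont A)) (Orth (Cont B))

Red : Form → Term → Set
Red A = Orth (Cont A)

-- Running a reducible term against the empty stack shows that the term itself is SN.
cont-nil : ∀ A → Cont A []
cont-nil (atom _) = refl
cont-nil ⊥′       = refl
cont-nil (A ⇒ B)  = nil
cont-nil (A ∧ B)  = nil
cont-nil (A ∨ B)  = nil

red-▷ : ∀ A {M M′} → Red A M → M ▷ M′ → Red A M′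
red-▷ A m r {V} k = acc-inverse (m k) (apps-▷ˡ V r)

-- A stack may reduce before its head interacts with it, so the inductions below must carry
-- admissibility along.
cont-▷ₛ : ∀ A {V V′} → Cont A V → V ▷ₛ V′ → Cont A V′
cont-▷ₛ (atom _) refl ()
cont-▷ₛ ⊥′       refl ()
cont-▷ₛ (A ⇒ B) (arg p k) (elim (c-tm r)) = arg (red-▷ A p r) k
cont-▷ₛ (A ⇒ B) (arg p k) (tail s)        = arg p (cont-▷ₛ B k s)
cont-▷ₛ (A ∧ B) (fst k)   (tail s)        = fst (cont-▷ₛ A k s)
cont-▷ₛ (A ∧ B) (snd k)   (tail s)        = snd (cont-▷ₛ B k s)
cont-▷ₛ (A ∨ B) (branch {V = V} f g) (elim (c-caseˡ r)) =
  branch (λ p → acc-inverse (f p) (apps-▷ˡ V (substI-▷ r))) g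
cont-▷ₛ (A ∨ B) (branch {V = V} f g) (elim (c-caseʳ r)) =
  branch f (λ p → acc-inverse (g p) (apps-▷ˡ V (substI-▷ r)))
cont-▷ₛ (A ∨ B) (branch f g) (tail s) =
  branch (λ p → acc-inverse (f p) (apps-▷ʳ s)) (λ p → acc-inverse (g p) (apps-▷ʳ s))
cont-▷ₛ (A ∨ B) (branch f g) (merge {N₁} {N₂} {E} {V}) =
  branch (λ {P} p → SN-merge P N₁ E V (f p)) (λ {P} p → SN-merge P N₂ E V (g p))

cont-▷ₛ* : ∀ A {V V′} → Cont A V → Star _▷ₛ_ V V′ → Cont A V′
cont-▷ₛ* A k refl*    = k
cont-▷ₛ* A k (s ◅ ss) = cont-▷ₛ* A (cont-▷ₛ A k s) ss

mutual
  -- Mutual with `var-red` by recursion on the formula: a case eliminator is known only through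
  -- instances of its branches at reducible terms, and variables of the smaller formulas provide
  -- them.
  cont-SNₛ : ∀ A {V} → Cont A V → SNₛ V
  cont-SNₛ (atom _) refl      = []-SNₛ
  cont-SNₛ ⊥′       refl      = []-SNₛ
  cont-SNₛ (A ⇒ B)  nil       = []-SNₛ
  cont-SNₛ (A ⇒ B)  (arg p k) = tm-SNₛ (p (cont-nil A)) (cont-SNₛ B k)
  cont-SNₛ (A ∧ B)  nil       = []-SNₛ
  cont-SNₛ (A ∧ B)  (fst k)   = π₁-SNₛ (cont-SNₛ A k)
  cont-SNₛ (A ∧ B)  (snd k)   = π₂-SNₛ (cont-SNₛ B k)
  cont-SNₛ (A ∨ B)  nil       = []-SNₛ
  cont-SNₛ (A ∨ B)  (branch {V = V} f g) =
    case-SNₛ (length V) ≤-refl (f (var-red A 0)) (g (var-red B 0))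

  var-red : ∀ A x → Red A (var x)
  var-red A x k = var-SN (cont-SNₛ A k)

-- Introduction forms against admissible stacks.

lam-SN : ∀ A B {M V} → SN M → (∀ {P} → Red A P → Red B (substI 0 P M)) →
         SNₛ V → Cont (A ⇒ B) V → SN (apps (lam M) V)
lam-SN A B {M} {V} (acc m) h (acc v) k = acc (step k ∘ apps-step V)
  where
  step : ∀ {T} → Cont (A ⇒ B) V → AppsStep (lam M) V T → SN T
  step k (head (c-lam r)) =
    lam-SN A B (m r) (λ p → red-▷ B (h p) (substI-▷ r)) (acc v) k
  step k (stack s)         = lam-SN A B (acc m) h (v s) (cont-▷ₛ (A ⇒ B) k s)
  step (arg p k) (cut cut-β) = h p k

-- SN of the components is passed beside their reducibility to serve, with SN of the stack, as
-- induction measure. A projection cut leaves a component facing a stack of its own formula.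
pair-SN : ∀ A B {M N V} → SN M → SN N → Red A M → Red B N →
          SNₛ V → Cont (A ∧ B) V → SN (apps (pair M N) V)
pair-SN A B {M} {N} {V} (acc sm) (acc sn) m n (acc v) k = acc (step k ∘ apps-step V)
  where
  step : ∀ {T} → Cont (A ∧ B) V → AppsStep (pair M N) V T → SN T
  step k (head (c-pairˡ r))   = pair-SN A B (sm r) (acc sn) (red-▷ A m r) n (acc v) k
  step k (head (c-pairʳ r))   = pair-SN A B (acc sm) (sn r) m (red-▷ B n r) (acc v) k
  step k (stack s)            =
    pair-SN A B (acc sm) (acc sn) m n (v s) (cont-▷ₛ (A ∧ B) k s)
  step (fst k) (cut cut-π₁)   = m k
  step (snd k) (cut cut-π₂)   = n k

ω₁-SN : ∀ A B {M V} → SN M → Red A M → SNₛ V → Cont (A ∨ B) V → SN (apps (ω₁ M) V)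
ω₁-SN A B {M} {V} (acc sm) m (acc v) k = acc (step k ∘ apps-step V)
  where
  step : ∀ {T} → Cont (A ∨ B) V → AppsStep (ω₁ M) V T → SN T
  step k (head (c-ω₁ r))           = ω₁-SN A B (sm r) (red-▷ A m r) (acc v) k
  step k (stack s)                 = ω₁-SN A B (acc sm) m (v s) (cont-▷ₛ (A ∨ B) k s)
  step (branch f g) (cut cut-ω₁)   = f m

ω₂-SN : ∀ A B {M V} → SN M → Red B M → SNₛ V → Cont (A ∨ B) V → SN (apps (ω₂ M) V)
ω₂-SN A B {M} {V} (acc sm) m (acc v) k = acc (step k ∘ apps-step V)
  where
  step : ∀ {T} → Cont (A ∨ B) V → AppsStep (ω₂ M) V T → SN T
  step k (head (c-ω₂ r))           = ω₂-SN A B (sm r) (red-▷ B m r) (acc v) k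
  step k (stack s)                 = ω₂-SN A B (acc sm) m (v s) (cont-▷ₛ (A ∨ B) k s)
  step (branch f g) (cut cut-ω₂)   = g m

-- The hypothesis ranges over the reducts V′ of V because M[a:=*V] need not
-- reduce properly when V does: a may not occur in M.
mutual
  mu-SN : ∀ n {M V} → length V ≤ n → SN M → SNₛ V →
          (∀ {V′} → Star _▷ₛ_ V V′ → SN (instC V′ M)) → SN (apps (mu M) V)
  mu-SN n {V = V} l m v h = acc (mu-step n l m v h ∘ apps-step V)

  mu-step : ∀ n {M V T} → length V ≤ n → SN M → SNₛ V →
            (∀ {V′} → Star _▷ₛ_ V V′ → SN (instC V′ M)) →
            AppsStep (mu M) V T → SN T
  mu-step n l (acc m) v h (head (c-mu r)) =
    mu-SN n l (m r) v (λ ss → acc-inverse (h ss) (sub-▷ r))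
  mu-step n l m (acc v) h (stack s) =
    mu-SN n (≤-trans (length-▷ₛ s) l) m (v s) (λ ss → h (s ◅ ss))
  -- The accessibility proof of the new body is not smaller than that of `M`, so the recursion rests
  -- on the shorter stack. SN of that body is reflected from its instance at `V`.
  mu-step (suc n) {M} (s≤s l) m v h (cut {E} {V} cut-μ) =
    mu-SN n l (SN-sub⁻ (h′ refl*)) (tail-SNₛ v) h′
    where
    h′ : ∀ {V′} → Star _▷ₛ_ V V′ → SN (instC V′ (ssub 0 (shiftCE 0 E) M))
    -- The absorbed `E` returns to the front of the stack, where reductions of the tail are
    -- reductions of the whole.
    h′ ss = subst SN (sym (instC-ssub E M)) (h (gmap (E ∷_) tail ss))

-- Reducibility of typed terms.

RedI : List Form → (ℕ → Term) → Set
RedI Γ τ = ∀ {x A} → Γ ∋ x ∶ A → Red A (τ x)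

RedC : List Form → (ℕ → Cov) → Set
RedC Δ θ = ∀ {a A} → Δ ∋ a ∶ A → Cont A (proj₂ (θ a))

RedI-• : ∀ {Γ τ A P} → Red A P → RedI Γ τ → RedI (A ∷ Γ) (P • τ)
RedI-• p g here      = p
RedI-• p g (there i) = g i

RedC-• : ∀ {Δ θ A b V} → Cont A V → RedC Δ θ → RedC (A ∷ Δ) ((b , V) • θ)
RedC-• k d here      = k
RedC-• k d (there i) = d i

SN-substI⁻ : ∀ {P M} → SN (substI 0 P M) → SN M
SN-substI⁻ {P} {M} s = SN-sub⁻ (subst SN (substI₀ P M) s)

mutual
  -- Induction on the typing: an elimination pushes its eliminator onto the stack, while a binder
  -- extends the substitution.
  reducible : ∀ {Γ Δ M A τ θ} → Γ ∣ Δ ⊢ M ∶ A → RedI Γ τ → RedC Δ θ → Red A (sub τ θ M)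
  reducible (t-var i) g d k = g i k
  reducible {τ = τ} {θ} (t-pair {M} {N} {A} {B} m n) g d k =
    pair-SN A B (rm (cont-nil A)) (rn (cont-nil B)) rm rn (cont-SNₛ (A ∧ B) k) k
    where
    rm : Red A (sub τ θ M)
    rm = reducible m g d
    rn : Red B (sub τ θ N)
    rn = reducible n g d
  reducible (t-π₁ m) g d k = reducible m g d (fst k)
  reducible (t-π₂ m) g d k = reducible m g d (snd k)
  reducible (t-lam {A = A} {B} m) g d k =
    -- SN of the open body is reflected from its instance at a variable.
    lam-SN A B (SN-substI⁻ (reducible-substI m g d (var-red A 0) (cont-nil B)))
           (reducible-substI m g d) (cont-SNₛ (A ⇒ B) k) k
  reducible (t-app m n) g d k = reducible m g d (arg (reducible n g d) k)
  reducible (t-ω₁ {A = A} {B} m) g d k =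
    ω₁-SN A B (reducible m g d (cont-nil A)) (reducible m g d) (cont-SNₛ (A ∨ B) k) k
  reducible (t-ω₂ {A = A} {B} m) g d k =
    ω₂-SN A B (reducible m g d (cont-nil B)) (reducible m g d) (cont-SNₛ (A ∨ B) k) k
  reducible {τ = τ} {θ} (t-case {N₁ = N₁} {N₂} m n₁ n₂) g d {V} k =
    -- The stack `V` for the result is carried behind the case, where each branch instance is run
    -- against it.
    reducible m g d {subE τ θ (case N₁ N₂) ∷ V}
                    (branch (λ p → reducible-substI n₁ g d p k)
                            (λ p → reducible-substI n₂ g d p k))
  reducible {θ = θ} (t-mu {M} {A} m) g d {V} k =
    mu-SN (length V) ≤-refl (SN-sub⁻ (inst (cont-nil A))) (cont-SNₛ A k)
          (λ ss → inst (cont-▷ₛ* A k ss))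
    where
    inst : ∀ {W} → Cont A W → SN (instC W (sub _ (liftC θ) M))
    inst k = subst SN (sym (instC-subC θ M)) (reducible m g (RedC-• k d) refl)
  reducible (t-capp i m) g d refl = capp-SN (reducible m g d (d i))

  reducible-substI : ∀ {Γ Δ M A B τ θ} → (A ∷ Γ) ∣ Δ ⊢ M ∶ B → RedI Γ τ → RedC Δ θ →
    ∀ {P} → Red A P → Red B (substI 0 P (sub (liftI τ) (renC suc id ∘ θ) M))
  reducible-substI {M = M} {B = B} {θ = θ} m g d {P} p {V} k =
    subst (λ N → SN (apps N V)) (sym (substI-subI θ P M)) (reducible m (RedI-• p g) d k)

strong-normalization : ∀ {Γ Δ M A} → Γ ∣ Δ ⊢ M ∶ A → SN M
strong-normalization {M = M} {A} m =
  subst SN (sub-id (λ _ → refl) (λ _ → refl) M)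
    (reducible {τ = var} {θ = idC} m (λ {x} {B} _ → var-red B x) (λ {_} {B} _ → cont-nil B)
      (cont-nil A))

theorem3p8 : (N N₁ N₂ : Term) (ε : Elim) (V : List Elim) →
    Nice (ε ∷ V) →
    Typed (apps (app (app N (case N₁ N₂)) ε) V) →
    Typed (apps (app N (case (app N₁ (shiftIE 0 ε)) (app N₂ (shiftIE 0 ε)))) V) →
    SN (apps (app N (case (app N₁ (shiftIE 0 ε)) (app N₂ (shiftIE 0 ε)))) V) →
    SN (apps (app (app N (case N₁ N₂)) ε) V)
theorem3p8 _ _ _ _ _ _ (_ , _ , _ , ⊢S₁) _ _ = strong-normalization ⊢S₁
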